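{- The class of $(\overline{P_1+P_3},\,K_{1,3}+3P_1)$-free graphs has bounded clique-width.
   Context: All graphs are finite, simple and undirected. For a family of graphs $\{H_1,\ldots,H_p\}$, a graph $G$ is $(H_1,\ldots,H_p)$-free if no induced subgraph of $G$ is isomorphic to any $H_i$. $P_r$ denotes the path on $r$ vertices, $K_{1,3}$ the claw (star with three leaves); $G+H$ is the disjoint union of $G$ and $H$, $sG$ is the disjoint union of $s$ copies of $G$; $\overline{G}$ denotes the complement of $G$. The clique-width of a graph $G$ is the minimum number of labels needed to construct $G$ using the operations: create a single vertex with label $i$; take the disjoint union of two labelled graphs; add all edges between vertices labelled $i$ and vertices labelled $j$ ($i\neq j$); rename label $i$ to $j$. A class of graphs has bounded clique-width if there is a constant $c$ such that every graph in the class has clique-width at most $c$. -}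

module Defs where

open import Data.Nat using (ℕ; zero; suc; _+_; _*_; _≡ᵇ_)
open import Data.Fin using (Fin; toℕ; splitAt; _≟_)
open import Data.Bool using (Bool; true; false; _∧_; _∨_; not; if_then_else_)
open import Data.Bool.Properties using (∨-comm; ∧-comm)
open import Data.Sum using (_⊎_; inj₁; inj₂)
open import Data.Product using (Σ; _×_; _,_; ∃)
open import Relation.Nullary using (¬_; ⌊_⌋)
open import Relation.Binary.PropositionalEquality using (_≡_; _≢_; refl; cong; cong₂)
open import Function.Definitions using (Injective)

record Graph (n : ℕ) : Set where
  field
    adj    : Fin n → Fin n → Bool
    sym    : ∀ u v → adj u v ≡ adj v u
    irrefl : ∀ u → adj u u ≡ false
open Graph public

≡ᵇ-refl : ∀ m → (m ≡ᵇ m) ≡ true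
≡ᵇ-refl zero = refl
≡ᵇ-refl (suc m) = ≡ᵇ-refl m

≡ᵇ-sym : ∀ m n → (m ≡ᵇ n) ≡ (n ≡ᵇ m)
≡ᵇ-sym zero zero = refl
≡ᵇ-sym zero (suc n) = refl
≡ᵇ-sym (suc m) zero = refl
≡ᵇ-sym (suc m) (suc n) = ≡ᵇ-sym m n

suc≢ᵇ : ∀ m → (suc m ≡ᵇ m) ≡ false
suc≢ᵇ zero = refl
suc≢ᵇ (suc m) = suc≢ᵇ m

emptyGraph : Graph 0
emptyGraph = record { adj = λ () ; sym = λ () ; irrefl = λ () }

complement : ∀ {n} → Graph n → Graph n
complement {n} G = record { adj = a ; sym = s ; irrefl = i }
  where
  a : Fin n → Fin n → Bool
  a u v = not (adj G u v) ∧ not (toℕ u ≡ᵇ toℕ v)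
  s : ∀ u v → a u v ≡ a v u
  s u v = cong₂ (λ x y → not x ∧ not y) (sym G u v) (≡ᵇ-sym (toℕ u) (toℕ v))
  i : ∀ u → a u u ≡ false
  i u with toℕ u ≡ᵇ toℕ u | ≡ᵇ-refl (toℕ u)
  ... | .true | refl with adj G u u
  ... | true = refl
  ... | false = refl

_⊕_ : ∀ {m n} → Graph m → Graph n → Graph (m + n)
_⊕_ {m} {n} G H = record { adj = a ; sym = s ; irrefl = i }
  where
  a : Fin (m + n) → Fin (m + n) → Bool
  a u v with splitAt m u | splitAt m v
  ... | inj₁ x | inj₁ y = adj G x y
  ... | inj₂ x | inj₂ y = adj H x y
  ... | inj₁ _ | inj₂ _ = false
  ... | inj₂ _ | inj₁ _ = false
  s : ∀ u v → a u v ≡ a v u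
  s u v with splitAt m u | splitAt m v
  ... | inj₁ x | inj₁ y = sym G x y
  ... | inj₂ x | inj₂ y = sym H x y
  ... | inj₁ _ | inj₂ _ = refl
  ... | inj₂ _ | inj₁ _ = refl
  i : ∀ u → a u u ≡ false
  i u with splitAt m u
  ... | inj₁ x = irrefl G x
  ... | inj₂ x = irrefl H x

copies : ∀ {n} (s : ℕ) → Graph n → Graph (s * n)
copies zero G = emptyGraph
copies (suc s) G = G ⊕ copies s G

P : (r : ℕ) → Graph r
P r = record { adj = a ; sym = s ; irrefl = i }
  where
  a : Fin r → Fin r → Bool
  a u v = (suc (toℕ u) ≡ᵇ toℕ v) ∨ (suc (toℕ v) ≡ᵇ toℕ u)
  s : ∀ u v → a u v ≡ a v u
  s u v = ∨-comm (suc (toℕ u) ≡ᵇ toℕ v) (suc (toℕ v) ≡ᵇ toℕ u)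
  i : ∀ u → a u u ≡ false
  i u rewrite suc≢ᵇ (toℕ u) = refl

claw : Graph 4
claw = record { adj = a ; sym = s ; irrefl = i }
  where
  isC : Fin 4 → Bool
  isC u = toℕ u ≡ᵇ 0
  a : Fin 4 → Fin 4 → Bool
  a u v = (isC u ∧ not (isC v)) ∨ (isC v ∧ not (isC u))
  s : ∀ u v → a u v ≡ a v u
  s u v = ∨-comm (isC u ∧ not (isC v)) (isC v ∧ not (isC u))
  i : ∀ u → a u u ≡ false
  i u with isC u
  ... | true = refl
  ... | false = refl

_≤ᵢ_ : ∀ {m n} → Graph m → Graph n → Set
_≤ᵢ_ {m} {n} H G =
  Σ (Fin m → Fin n) λ f → Injective _≡_ _≡_ f × (∀ i j → adj G (f i) (f j) ≡ adj H i j)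

Free : ∀ {m n} → Graph m → Graph n → Set
Free H G = ¬ (H ≤ᵢ G)

_≅_ : ∀ {n} → Graph n → Graph n → Set
_≅_ {n} G H =
  Σ (Fin n → Fin n) λ f → Injective _≡_ _≡_ f × (∀ u v → adj H (f u) (f v) ≡ adj G u v)

data Expr (k : ℕ) : ℕ → Set where
  vtx    : Fin k → Expr k 1
  union  : ∀ {m n} → Expr k m → Expr k n → Expr k (m + n)
  join   : ∀ {n} (i j : Fin k) → i ≢ j → Expr k n → Expr k n
  rename : ∀ {n} (i j : Fin k) → Expr k n → Expr k n

label : ∀ {k n} → Expr k n → Fin n → Fin k
label (vtx i) _ = i
label (union {m} e f) u with splitAt m u
... | inj₁ x = label e x
... | inj₂ x = label f x
label (join _ _ _ e) u = label e u
label (rename i j e) u = if ⌊ label e u ≟ i ⌋ then j else label e u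

eadj : ∀ {k n} → Expr k n → Fin n → Fin n → Bool
eadj (vtx _) _ _ = false
eadj (union {m} e f) u v with splitAt m u | splitAt m v
... | inj₁ x | inj₁ y = eadj e x y
... | inj₂ x | inj₂ y = eadj f x y
... | inj₁ _ | inj₂ _ = false
... | inj₂ _ | inj₁ _ = false
eadj (join i j _ e) u v =
  eadj e u v ∨ ((⌊ label e u ≟ i ⌋ ∧ ⌊ label e v ≟ j ⌋) ∨ (⌊ label e u ≟ j ⌋ ∧ ⌊ label e v ≟ i ⌋))
eadj (rename _ _ e) u v = eadj e u v

-- G has clique-width at most k: G is the underlying (unlabelled) graph of some
-- k-expression, up to isomorphism.  The graph with no vertices is taken to have
-- clique-width 0 (it cannot be built by the operations).
CwAtMost : ∀ {n} → ℕ → Graph n → Set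
CwAtMost {n} k G =
  n ≡ 0 ⊎ Σ (Expr k n) λ e →
    Σ (Fin n → Fin n) λ f → Injective _≡_ _≡_ f × (∀ u v → eadj e (f u) (f v) ≡ adj G u v)

BoundedCliqueWidth : (∀ {n} → Graph n → Set) → Set
BoundedCliqueWidth 𝒢 = ∃ λ c → ∀ {n} (G : Graph n) → 𝒢 G → CwAtMost c G

{-# OPTIONS --safe #-}
module Submission where

-- The complement of P₁ + P₃ is the paw.  In a paw-free graph the set of vertices
-- lying in a triangle is a union of components, and two of its non-adjacent
-- vertices with a common neighbour are twins, so those components are complete
-- multipartite.  The remaining vertices induce a triangle-free graph F.  There a
-- vertex has at most two neighbours or at most two non-neighbours in any
-- independent set D, since otherwise D and the vertex contain K₁,₃ + 3P₁; and a
-- set of at least six vertices contains three independent ones.  If F has a vertex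
-- x of degree at least 9, then all but at most five vertices of F outside N(x) miss at most
-- two vertices of N(x); they form an independent set, and after deleting boundedly
-- many vertices the bipartite complement between it and N(x) has maximum degree
-- at most two.  If all degrees are at most 8, then either F has no claw, so its
-- degrees are at most two, or all but at most five vertices have a neighbour in a given claw,
-- so F has at most 37 vertices.
--
-- Hence the vertices can be ordered (multipartite components part by part, then the
-- deleted vertices, then the paths and cycles one after the other) so that the
-- vertices of every initial segment have boundedly many distinct neighbourhoods
-- outside of it, which bounds the (linear) clique-width.

open import Defs renaming (sym to adj-sym)
open import Data.Nat using (ℕ; zero; suc; _+_; _≤_; _<_; z≤n; s≤s)
open import Data.Nat.Properties using (≤-trans; ≤-antisym; ≤-reflexive; +-mono-≤; 1+n≰n; _≤?_; +-suc; +-identityʳ; m≤n+m; m≤m+n; ≮⇒≥)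
open import Data.Fin using (Fin; zero; suc; _≟_; _↑ˡ_; _↑ʳ_; splitAt) renaming (_<_ to _<ᶠ_)
open import Data.Fin.Patterns using (0F; 1F; 2F; 3F; 4F; 5F; 6F)
open import Data.Fin.Properties using (<-cmp; any?; all?; injective⇒≤; ↑ˡ-injective; ↑ʳ-injective; suc-injective; splitAt-↑ˡ; splitAt-↑ʳ; 0≢1+n)
open import Data.Bool using (Bool; true; false; _∧_; _∨_; _xor_; if_then_else_)
open import Data.Bool.Properties using (∨-comm; ∧-comm; ∨-zeroʳ; ∨-identityʳ; xor-comm; xor-identityʳ) renaming (_≟_ to _≟ᵇ_)
open import Data.Sum using (_⊎_; inj₁; inj₂; swap; [_,_]′)
open import Data.Product using (Σ; _,_; ∃; _×_; proj₁; proj₂)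
open import Data.Unit using (⊤; tt)
open import Data.Empty using (⊥; ⊥-elim)
open import Data.List using (List; []; _∷_; _++_; length; lookup; filter; allFin; map)
open import Data.List.Properties using (length-++; length-map)
open import Data.List.Membership.Propositional using (_∈_; _∉_)
open import Data.List.Membership.Propositional.Properties using (∈-filter⁺; ∈-filter⁻; ∈-allFin; ∈-++⁺ˡ; ∈-++⁺ʳ; ∈-lookup; ∈-map⁺)
open import Data.List.Relation.Unary.Any using (here; there; index)
open import Data.List.Relation.Unary.Any.Properties using (lookup-index)
open import Data.List.Relation.Unary.All using ([]; _∷_)
open import Data.List.Relation.Unary.All.Properties using (¬Any⇒All¬)
import Data.List.Relation.Unary.All as All
open import Data.List.Relation.Unary.AllPairs using ([]; _∷_)
open import Data.List.Relation.Unary.Unique.Propositional using (Unique)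
open import Data.List.Relation.Unary.Unique.Propositional.Properties using (filter⁺; allFin⁺)
open import Relation.Nullary using (¬_; Dec; yes; no; ⌊_⌋; _×-dec_; ¬?; contradiction)
open import Relation.Nullary.Decidable using (decidable-stable)
open import Relation.Binary.Definitions using (tri<; tri≈; tri>)
open import Relation.Unary using (Decidable)
open import Relation.Binary.PropositionalEquality using (_≡_; _≢_; refl; sym; trans; cong; cong₂; subst)
open import Function using (_∘_; id)
open import Function.Definitions using (Injective)

-- Counting with lists without repetition

lookup-injective : ∀ {A : Set} {xs : List A} → Unique xs → Injective _≡_ _≡_ (lookup xs)
lookup-injective (_ ∷ _) {zero} {zero} _ = refl
lookup-injective {xs = _ ∷ xs} (x≢ ∷ _) {zero} {suc j} eq = contradiction eq (All.lookup x≢ (∈-lookup j))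
lookup-injective {xs = _ ∷ xs} (x≢ ∷ _) {suc i} {zero} eq = contradiction (sym eq) (All.lookup x≢ (∈-lookup i))
lookup-injective (_ ∷ u) {suc i} {suc j} eq = cong suc (lookup-injective u eq)

index-injective : ∀ {A : Set} {xs : List A} {x y : A} (p : x ∈ xs) (q : y ∈ xs) → index p ≡ index q → x ≡ y
index-injective {xs = xs} p q eq = trans (lookup-index p) (trans (cong (lookup xs) eq) (sym (lookup-index q)))

unique-⊆⇒length≤ : ∀ {A : Set} {xs ys : List A} → Unique xs → (∀ {x} → x ∈ xs → x ∈ ys) → length xs ≤ length ys
unique-⊆⇒length≤ {xs = xs} u sub = injective⇒≤ {f = λ i → index (sub (∈-lookup {xs = xs} i))}
  (λ {i} {j} eq → lookup-injective u (index-injective (sub (∈-lookup i)) (sub (∈-lookup j)) eq))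

length-++-≤ : ∀ {A : Set} {a b} (xs ys : List A) → length xs ≤ a → length ys ≤ b → length (xs ++ ys) ≤ a + b
length-++-≤ xs ys p q = ≤-trans (≤-reflexive (length-++ xs)) (+-mono-≤ p q)

⌊⌋-yes : ∀ {P : Set} (d : Dec P) → P → ⌊ d ⌋ ≡ true
⌊⌋-yes (yes _) _ = refl
⌊⌋-yes (no ¬p) p = contradiction p ¬p

⌊⌋-no : ∀ {P : Set} (d : Dec P) → ¬ P → ⌊ d ⌋ ≡ false
⌊⌋-no (no _) _ = refl
⌊⌋-no (yes p) ¬p = contradiction p ¬p

-- Iterated renaming and joining

renames : ∀ {K k m} (s t : Fin k → Fin K) → List (Fin k) → Expr K m → Expr K m
renames s t [] e = e
renames s t (i ∷ is) e = renames s t is (rename (s i) (t i) e)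

eadj-renames : ∀ {K k m} (s t : Fin k → Fin K) is (e : Expr K m) u v → eadj (renames s t is e) u v ≡ eadj e u v
eadj-renames s t [] e u v = refl
eadj-renames s t (i ∷ is) e u v = eadj-renames s t is (rename (s i) (t i) e) u v

module _ {K k : ℕ} (s t : Fin k → Fin K) (s-inj : Injective _≡_ _≡_ s) (t≢s : ∀ i j → t i ≢ s j) where

  -- A vertex that has reached its target label stays there, because no target is the source of a
  -- later renaming.
  label-renames-target : ∀ {m} is (e : Expr K m) u j → label e u ≡ t j → label (renames s t is e) u ≡ t j
  label-renames-target [] e u j eq = eq
  label-renames-target (i ∷ is) e u j eq = label-renames-target is (rename (s i) (t i) e) u j step
    where
    step : label (rename (s i) (t i) e) u ≡ t j
    step rewrite ⌊⌋-no (label e u ≟ s i) (λ q → t≢s j i (trans (sym eq) q)) = eq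

  label-renames-source : ∀ {m} is (e : Expr K m) u j → j ∈ is → label e u ≡ s j → label (renames s t is e) u ≡ t j
  label-renames-source (i ∷ is) e u j j∈ eq with j ≟ i
  ... | yes refl = label-renames-target is (rename (s i) (t i) e) u j step
    where
    step : label (rename (s j) (t j) e) u ≡ t j
    step rewrite ⌊⌋-yes (label e u ≟ s j) eq = refl
  label-renames-source (i ∷ is) e u j (here j≡i) eq | no j≢i = contradiction j≡i j≢i
  label-renames-source (i ∷ is) e u j (there j∈) eq | no j≢i =
    label-renames-source is (rename (s i) (t i) e) u j j∈ step
    where
    step : label (rename (s i) (t i) e) u ≡ s j
    step rewrite ⌊⌋-no (label e u ≟ s i) (λ q → j≢i (s-inj (trans (sym eq) q))) = eq

module Joins {K k : ℕ} (z : Fin K) (s : Fin k → Fin K) (s-inj : Injective _≡_ _≡_ s) (z≢s : ∀ i → z ≢ s i) (b : Fin k → Bool) where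

  joins : ∀ {m} → List (Fin k) → Expr K m → Expr K m
  joins [] e = e
  joins (i ∷ is) e = if b i then join z (s i) (z≢s i) (joins is e) else joins is e

  label-joins : ∀ {m} is (e : Expr K m) u → label (joins is e) u ≡ label e u
  label-joins [] e u = refl
  label-joins (i ∷ is) e u with b i
  ... | true = label-joins is e u
  ... | false = label-joins is e u

  private
    test : ∀ {m} → Expr K m → Fin k → Fin m → Fin m → Bool
    test e i u v = (⌊ label e u ≟ z ⌋ ∧ ⌊ label e v ≟ s i ⌋) ∨ (⌊ label e u ≟ s i ⌋ ∧ ⌊ label e v ≟ z ⌋)

  eadj-joins-false : ∀ {m} is (e : Expr K m) u v → (∀ i → b i ≡ true → test e i u v ≡ false) →
    eadj (joins is e) u v ≡ eadj e u v
  eadj-joins-false [] e u v h = refl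
  eadj-joins-false (i ∷ is) e u v h with b i in eq
  ... | false = eadj-joins-false is e u v h
  ... | true rewrite label-joins is e u | label-joins is e v | h i eq =
    trans (∨-identityʳ _) (eadj-joins-false is e u v h)

  eadj-joins-true : ∀ {m} is (e : Expr K m) u v i → i ∈ is → b i ≡ true → test e i u v ≡ true →
    eadj (joins is e) u v ≡ true
  eadj-joins-true (i ∷ is) e u v .i (here refl) bi h rewrite bi | label-joins is e u | label-joins is e v | h = ∨-zeroʳ _
  eadj-joins-true (i ∷ is) e u v j (there j∈) bj h with b i
  ... | false = eadj-joins-true is e u v j j∈ bj h
  ... | true rewrite eadj-joins-true is e u v j j∈ bj h = refl

  -- A join needs one end labelled `z` and the other labelled `s i`; the two hypotheses exclude the
  -- two orientations.
  eadj-joins-apart : ∀ {m} is (e : Expr K m) u v → (∀ i → label e u ≢ s i) ⊎ label e v ≢ z →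
    (∀ i → label e v ≢ s i) ⊎ label e u ≢ z → eadj (joins is e) u v ≡ eadj e u v
  eadj-joins-apart is e u v p q = eadj-joins-false is e u v λ i _ → cong₂ _∨_ (left q i) (right p i)
    where
    left : (∀ i → label e v ≢ s i) ⊎ label e u ≢ z → ∀ i → (⌊ label e u ≟ z ⌋ ∧ ⌊ label e v ≟ s i ⌋) ≡ false
    left (inj₂ ne) i rewrite ⌊⌋-no (label e u ≟ z) ne = refl
    left (inj₁ ne) i rewrite ⌊⌋-no (label e v ≟ s i) (ne i) with ⌊ label e u ≟ z ⌋
    ... | true = refl
    ... | false = refl
    right : (∀ i → label e u ≢ s i) ⊎ label e v ≢ z → ∀ i → (⌊ label e u ≟ s i ⌋ ∧ ⌊ label e v ≟ z ⌋) ≡ false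
    right (inj₁ ne) i rewrite ⌊⌋-no (label e u ≟ s i) (ne i) = refl
    right (inj₂ ne) i rewrite ⌊⌋-no (label e v ≟ z) ne with ⌊ label e u ≟ s i ⌋
    ... | true = refl
    ... | false = refl

  eadj-joins : ∀ {m} is (e : Expr K m) u v j → j ∈ is → label e u ≡ z → label e v ≡ s j → eadj e u v ≡ false →
    eadj (joins is e) u v ≡ b j
  eadj-joins is e u v j j∈ lu lv ev with b j in bj
  ... | true = eadj-joins-true is e u v j j∈ bj hit
    where
    hit : test e j u v ≡ true
    hit rewrite ⌊⌋-yes (label e u ≟ z) lu | ⌊⌋-yes (label e v ≟ s j) lv = refl
  -- By injectivity of `s`, only the join of index `j` could connect the two classes, and it is not
  -- performed.
  ... | false = trans (eadj-joins-false is e u v miss) ev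
    where
    miss : ∀ i → b i ≡ true → test e i u v ≡ false
    miss i bi
      rewrite ⌊⌋-yes (label e u ≟ z) lu
      | ⌊⌋-no (label e v ≟ s i) (λ q → contradiction (trans (sym bi) (trans (cong b (s-inj (trans (sym q) lv))) bj)) λ ())
      | ⌊⌋-no (label e u ≟ s i) (λ q → z≢s i (trans (sym lu) q)) = refl

  eadj-joins-sym : ∀ {m} is (e : Expr K m) u v → eadj e u v ≡ eadj e v u → eadj (joins is e) u v ≡ eadj (joins is e) v u
  eadj-joins-sym [] e u v h = h
  eadj-joins-sym (i ∷ is) e u v h with b i
  ... | false = eadj-joins-sym is e u v h
  ... | true = cong₂ _∨_ (eadj-joins-sym is e u v h)
    (trans (∨-comm (⌊ label (joins is e) u ≟ z ⌋ ∧ _) _) (cong₂ _∨_ (∧-comm ⌊ label (joins is e) u ≟ s i ⌋ _) (∧-comm ⌊ label (joins is e) u ≟ z ⌋ _)))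

-- Linear layouts

pad : ∀ {A : Set} → A → List A → ∀ {k} → Fin k → A
pad d [] _ = d
pad d (x ∷ xs) zero = x
pad d (x ∷ xs) (suc i) = pad d xs i

pad-∈ : ∀ {A : Set} (d : A) {xs x k} → length xs ≤ k → x ∈ xs → ∃ λ (i : Fin k) → pad d xs i ≡ x
pad-∈ d (s≤s le) (here refl) = zero , refl
pad-∈ d (s≤s le) (there x∈) with pad-∈ d le x∈
... | i , eq = suc i , eq

module Layouts {n : ℕ} (G : Graph n) where

  V : Set
  V = Fin n

  Covers : List V → (V → Bool) → V → Set
  Covers L r u = ∀ x → x ∉ L → adj G u x ≡ r x

  -- Only a covering is asked for, so a shorter list of patterns can be padded to `k`.
  record FewPatterns (k : ℕ) (L : List V) : Set where
    constructor patterns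
    field
      pattern-of : Fin k → V → Bool
      covered : ∀ u → u ∈ L → ∃ λ j → Covers L (pattern-of j) u

  fewPatterns : ∀ {k L} (R : List (V → Bool)) → length R ≤ k →
    (∀ u → u ∈ L → ∃ λ r → r ∈ R × Covers L r u) → FewPatterns k L
  fewPatterns {k} {L} R le h = patterns (pad (λ _ → false) R) cov
    where
    cov : ∀ u → u ∈ L → ∃ λ j → Covers L (pad (λ _ → false) R {k} j) u
    cov u u∈ with h u u∈
    ... | r , r∈ , c with pad-∈ (λ _ → false) le r∈
    ... | j , eq = j , λ x x∉ → trans (c x x∉) (sym (cong (λ f → f x) eq))

  -- The most recently placed vertex is the head of the list.
  data Layout (k : ℕ) : List V → Set where
    [] : Layout k []
    add : ∀ {w L} → w ∉ L → FewPatterns k (w ∷ L) → Layout k L → Layout k (w ∷ L)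

  layout-unique : ∀ {k L} → Layout k L → Unique L
  layout-unique [] = []
  layout-unique {L = w ∷ L} (add w∉ _ l) = ¬Any⇒All¬ L w∉ ∷ layout-unique l

  open import Data.List.Membership.DecPropositional (_≟_ {n}) using (_∈?_) public

  -- From a layout to a clique-width expression

  module Build (k : ℕ) where

    K : ℕ
    K = suc k + suc k

    -- Renamings are sequential, so a simultaneous relabelling passes through a second
    -- copy of the labels.  Label zero is reserved for the vertex being added.
    low high : Fin (suc k) → Fin K
    low i = i ↑ˡ suc k
    high i = suc k ↑ʳ i

    low-inj : Injective _≡_ _≡_ low
    low-inj = ↑ˡ-injective (suc k) _ _

    high-inj : Injective _≡_ _≡_ high
    high-inj = ↑ʳ-injective (suc k) _ _

    high≢low : ∀ i j → high i ≢ low j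
    high≢low i j eq with trans (sym (splitAt-↑ʳ (suc k) (suc k) i)) (trans (cong (splitAt (suc k)) eq) (splitAt-↑ˡ (suc k) j (suc k)))
    ... | ()

    low≢high : ∀ i j → low i ≢ high j
    low≢high i j eq = high≢low j i (sym eq)

    -- The label of a vertex determines its neighbours outside of `L`. Hence the next vertex sees
    -- all or nothing of each label class and can be attached by joins.
    record Built (L : List V) : Set where
      field
        expr : Expr K (length L)
        lab : Fin (length L) → Fin k
        pattern-of : Fin k → V → Bool
        label-lab : ∀ i → label expr i ≡ low (suc (lab i))
        covered : ∀ i → Covers L (pattern-of (lab i)) (lookup L i)
        eadj-adj : ∀ i j → eadj expr i j ≡ adj G (lookup L i) (lookup L j)

    built-single : ∀ w → FewPatterns k (w ∷ []) → Built (w ∷ [])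
    built-single w (patterns R cov) with cov w (here refl)
    ... | j , c = record
      { expr = vtx (low (suc j)) ; lab = λ _ → j ; pattern-of = R ; label-lab = λ _ → refl
      ; covered = λ { zero → c } ; eadj-adj = λ { zero zero → sym (irrefl G w) } }

    module Step {w : V} {L : List V} (w∉L : w ∉ L) (few : FewPatterns k (w ∷ L)) (built : Built L) where
      open Built built
      open FewPatterns few renaming (pattern-of to pattern′; covered to covered′)

      Matches : (V → Bool) → Fin k → Set
      Matches r j = ∀ x → x ∉ w ∷ L → r x ≡ pattern′ j x

      matches? : ∀ r j → Dec (Matches r j)
      matches? r j with any? (λ x → ¬? (x ∈? (w ∷ L)) ×-dec ¬? (r x ≟ᵇ pattern′ j x))
      ... | yes (x , x∉ , ne) = no λ m → ne (m x x∉)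
      ... | no none = yes λ x x∉ → decidable-stable (r x ≟ᵇ pattern′ j x) λ ne → none (x , x∉ , ne)

      new : Fin k
      new = proj₁ (covered′ w (here refl))

      relab : Fin k → Fin k
      relab i with any? (matches? (pattern-of i))
      ... | yes (j , _) = j
      -- Reached only for labels that no vertex carries; labels in use have a match.
      ... | no _ = new

      relab-matches : ∀ i → ∃ (Matches (pattern-of i)) → Matches (pattern-of i) (relab i)
      relab-matches i m with any? (matches? (pattern-of i))
      ... | yes (_ , p) = p
      ... | no ¬p = contradiction m ¬p

      z : Fin K
      z = low zero
      s : Fin k → Fin K
      s = low ∘ suc
      s-inj : Injective _≡_ _≡_ s
      s-inj = suc-injective ∘ low-inj
      z≢s : ∀ i → z ≢ s i
      z≢s i eq = 0≢1+n (low-inj eq)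

      bit : Fin k → Bool
      bit i = pattern-of i w

      open Joins z s s-inj z≢s bit

      ex₁ ex₂ ex₃ ex₄ : Expr K (suc (length L))
      ex₁ = union (vtx z) expr
      ex₂ = joins (allFin k) ex₁

      target : Fin (suc k) → Fin (suc k)
      target zero = suc new
      target (suc i) = suc (relab i)

      ex₃ = renames low (high ∘ target) (allFin (suc k)) ex₂
      ex₄ = renames high low (allFin (suc k)) ex₃

      before : Fin (suc (length L)) → Fin (suc k)
      before zero = zero
      before (suc i) = suc (lab i)

      after : Fin (suc (length L)) → Fin k
      after zero = new
      after (suc i) = relab (lab i)

      target-before : ∀ i → target (before i) ≡ suc (after i)
      target-before zero = refl
      target-before (suc i) = refl

      label₁ : ∀ i → label ex₁ i ≡ low (before i)
      label₁ zero = refl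
      label₁ (suc i) = label-lab i

      label₃ : ∀ i → label ex₃ i ≡ high (suc (after i))
      label₃ i = trans (label-renames-source low (high ∘ target) low-inj (λ p q → high≢low (target p) q) _ ex₂ i (before i) (∈-allFin _)
                   (trans (label-joins (allFin k) ex₁ i) (label₁ i))) (cong high (target-before i))

      label₄ : ∀ i → label ex₄ i ≡ low (suc (after i))
      label₄ i = label-renames-source high low high-inj low≢high _ ex₃ i _ (∈-allFin _) (label₃ i)

      -- The old pattern of a vertex is its true adjacency outside of `L`, so it matches the new
      -- pattern covering that vertex, and `relab` finds a match.
      covers₄ : ∀ i → Covers (w ∷ L) (pattern′ (after i)) (lookup (w ∷ L) i)
      covers₄ zero = proj₂ (covered′ w (here refl))
      covers₄ (suc i) x x∉ with covered′ (lookup L i) (there (∈-lookup i))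
      ... | j , c = trans (covered i x (x∉ ∘ there)) (relab-matches (lab i)
              (j , λ y y∉ → trans (sym (covered i y (y∉ ∘ there))) (c y y∉)) x x∉)

      -- Since `w` lies outside of `L`, the pattern of an old label evaluated at `w` is the true
      -- adjacency of `w` to every vertex with that label.
      eadj₂ : ∀ i j → eadj ex₂ i j ≡ adj G (lookup (w ∷ L) i) (lookup (w ∷ L) j)
      eadj₂ zero zero = trans (eadj-joins-apart (allFin k) ex₁ zero zero (inj₁ z≢s) (inj₁ z≢s)) (sym (irrefl G w))
      eadj₂ zero (suc j) = trans (eadj-joins (allFin k) ex₁ zero (suc j) (lab j) (∈-allFin _) refl (label-lab j) refl)
        (trans (sym (covered j w w∉L)) (adj-sym G (lookup L j) w))
      eadj₂ (suc i) zero = trans (eadj-joins-sym (allFin k) ex₁ (suc i) zero refl)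
        (trans (eadj₂ zero (suc i)) (adj-sym G w (lookup L i)))
      eadj₂ (suc i) (suc j) = trans (eadj-joins-apart (allFin k) ex₁ (suc i) (suc j) (inj₂ (old j)) (inj₂ (old i))) (eadj-adj i j)
        where
        old : ∀ i → label expr i ≢ z
        old i eq = z≢s (lab i) (trans (sym eq) (label-lab i))

      next : Built (w ∷ L)
      next = record
        { expr = ex₄ ; lab = after ; pattern-of = pattern′ ; label-lab = label₄ ; covered = covers₄
        ; eadj-adj = λ i j → trans (eadj-renames high low (allFin (suc k)) ex₃ i j)
            (trans (eadj-renames low (high ∘ target) (allFin (suc k)) ex₂ i j) (eadj₂ i j)) }

    build : ∀ {w L} → Layout k (w ∷ L) → Built (w ∷ L)
    build {w} (add _ few []) = built-single w few
    build (add w∉ few l@(add _ _ _)) = Step.next w∉ few (build l)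

  -- The labels are one per pattern and one for the arriving vertex, in two copies.
  spanning-layout⇒cw : ∀ {k L} → Layout k L → (∀ v → v ∈ L) → CwAtMost (suc k + suc k) G
  spanning-layout⇒cw {k} {[]} l all = inj₁ (≤-antisym (injective⇒≤ {f = index ∘ all} λ {u} {v} → index-injective (all u) (all v)) z≤n)
  spanning-layout⇒cw {k} {w ∷ L} l all = inj₂ (subst Presents size (expr , position , (λ {u} {v} → index-injective (all u) (all v)) , agree))
    where
    open Build k
    open Built (build l)
    Presents : ℕ → Set
    Presents m = Σ (Expr K m) λ e → Σ (Fin n → Fin m) λ f → Injective _≡_ _≡_ f × (∀ u v → eadj e (f u) (f v) ≡ adj G u v)
    position : Fin n → Fin (length (w ∷ L))
    position = index ∘ all
    size : length (w ∷ L) ≡ n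
    size = ≤-antisym (injective⇒≤ (lookup-injective (layout-unique l))) (injective⇒≤ {f = position} λ {u} {v} → index-injective (all u) (all v))
    agree : ∀ u v → eadj expr (position u) (position v) ≡ adj G u v
    agree u v = trans (eadj-adj _ _) (sym (cong₂ (adj G) (lookup-index (all u)) (lookup-index (all v))))

  -- An unplaced target vertex only signals that the phase goes on; `step` may place another vertex,
  -- chosen to keep the invariant.
  module Greedy {k : ℕ} (I : List V → Set) (Target : V → Set) (target? : Decidable Target)
    (few : ∀ {L} → I L → FewPatterns k L)
    (step : ∀ {L} → I L → ∀ v → v ∉ L → Target v → ∃ λ w → w ∉ L × I (w ∷ L)) where

    Result : Set
    Result = ∃ λ L → Layout k L × I L × (∀ v → Target v → v ∈ L)

    run : ∀ fuel {L} → Layout k L → I L → n < length L + fuel → Result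
    -- The placed vertices are distinct, hence at most `n`, so the fuel cannot run out first.
    run zero {L} l i lt = contradiction
      (≤-trans lt (≤-trans (≤-reflexive (+-identityʳ _)) (injective⇒≤ (lookup-injective (layout-unique l))))) 1+n≰n
    run (suc fuel) {L} l i lt with any? (λ v → ¬? (v ∈? L) ×-dec target? v)
    ... | no none = L , l , i , done
      where
      done : ∀ v → Target v → v ∈ L
      done v tv with v ∈? L
      ... | yes v∈ = v∈
      ... | no v∉ = contradiction (v , v∉ , tv) none
    ... | yes (v , v∉ , tv) with step i v v∉ tv
    ... | w , w∉ , i′ = run fuel (add w∉ (few i′) l) i′ (subst (n <_) (+-suc (length L) fuel) lt)

    extend : ∀ {L} → Layout k L → I L → Result
    extend {L} l i = run (suc n) l i (m≤n+m (suc n) (length L))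

-- Finite sets of vertices

module _ {n : ℕ} where

  record Three (P : Fin n → Set) : Set where
    constructor three
    field
      {x y z} : Fin n
      x≢y : x ≢ y
      x≢z : x ≢ z
      y≢z : y ≢ z
      px : P x
      py : P y
      pz : P z

  three-map : ∀ {P Q : Fin n → Set} → (∀ {v} → P v → Q v) → Three P → Three Q
  three-map f (three a b c px py pz) = three a b c (f px) (f py) (f pz)

  satisfying : ∀ {P : Fin n → Set} → Decidable P → List (Fin n)
  satisfying P? = filter P? (allFin n)

  module _ {P : Fin n → Set} (P? : Decidable P) where

    satisfying-unique : Unique (satisfying P?)
    satisfying-unique = filter⁺ P? (allFin⁺ n)

    ∈-satisfying : ∀ {v} → P v → v ∈ satisfying P?
    ∈-satisfying = ∈-filter⁺ P? (∈-allFin _)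

    satisfying-∈ : ∀ {v} → v ∈ satisfying P? → P v
    satisfying-∈ v∈ = proj₂ (∈-filter⁻ P? {xs = allFin n} v∈)

    three-or-few : Three P ⊎ length (satisfying P?) ≤ 2
    three-or-few = go (satisfying P?) satisfying-unique satisfying-∈
      where
      go : ∀ xs → Unique xs → (∀ {v} → v ∈ xs → P v) → Three P ⊎ length xs ≤ 2
      go [] _ _ = inj₂ z≤n
      go (_ ∷ []) _ _ = inj₂ (s≤s z≤n)
      go (_ ∷ _ ∷ []) _ _ = inj₂ (s≤s (s≤s z≤n))
      go (_ ∷ _ ∷ _ ∷ _) ((x≢y ∷ x≢z ∷ _) ∷ (y≢z ∷ _) ∷ _) p =
        inj₁ (three x≢y x≢z y≢z (p (here refl)) (p (there (here refl))) (p (there (there (here refl)))))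

    ¬three⇒few : ¬ Three P → length (satisfying P?) ≤ 2
    ¬three⇒few ¬t = [ (λ t → contradiction t ¬t) , id ]′ three-or-few

    few⇒¬three : length (satisfying P?) ≤ 2 → ¬ Three P
    few⇒¬three le (three {x} {y} {z} x≢y x≢z y≢z px py pz) =
      1+n≰n (≤-trans (unique-⊆⇒length≤ ((x≢y ∷ x≢z ∷ []) ∷ (y≢z ∷ []) ∷ [] ∷ []) sub) le)
      where
      sub : ∀ {v} → v ∈ x ∷ y ∷ z ∷ [] → v ∈ satisfying P?
      sub (here refl) = ∈-satisfying px
      sub (there (here refl)) = ∈-satisfying py
      sub (there (there (here refl))) = ∈-satisfying pz

    three? : Dec (Three P)
    three? with three-or-few
    ... | inj₁ t = yes t
    ... | inj₂ le = no (few⇒¬three le)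

-- Forbidden induced subgraphs

module Forbidden {n : ℕ} (G : Graph n) where

  open Layouts G public

  infix 4 _~_ _≁_
  _~_ _≁_ : V → V → Set
  u ~ v = adj G u v ≡ true
  u ≁ v = adj G u v ≡ false

  ~-or-≁ : ∀ u v → u ~ v ⊎ u ≁ v
  ~-or-≁ u v with adj G u v
  ... | true = inj₁ refl
  ... | false = inj₂ refl

  _~?_ : ∀ u v → Dec (u ~ v)
  u ~? v = adj G u v ≟ᵇ true

  _≁?_ : ∀ u v → Dec (u ≁ v)
  u ≁? v = adj G u v ≟ᵇ false

  ~-sym : ∀ {u v} → u ~ v → v ~ u
  ~-sym {u} {v} p = trans (adj-sym G v u) p

  ≁-sym : ∀ {u v} → u ≁ v → v ≁ u
  ≁-sym {u} {v} p = trans (adj-sym G v u) p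

  ~-≁-⊥ : ∀ {u v} → u ~ v → u ≁ v → ⊥
  ~-≁-⊥ p q with trans (sym p) q
  ... | ()

  ~⇒≢ : ∀ {u v} → u ~ v → u ≢ v
  ~⇒≢ {u} p refl = ~-≁-⊥ p (irrefl G u)

  separated : ∀ {u v w} → w ~ u → w ≁ v → u ≢ v
  separated p q refl = ~-≁-⊥ p q

  -- Pairs with `i` below `j` suffice, by symmetry and irreflexivity of both graphs.
  induced : ∀ {m} (H : Graph m) (f : Fin m → V) →
    (∀ i j → i <ᶠ j → f i ≢ f j × adj G (f i) (f j) ≡ adj H i j) → H ≤ᵢ G
  induced H f h = f , inj , agree
    where
    inj : Injective _≡_ _≡_ f
    inj {i} {j} eq with <-cmp i j
    ... | tri< lt _ _ = contradiction eq (proj₁ (h i j lt))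
    ... | tri≈ _ e _ = e
    ... | tri> _ _ gt = contradiction (sym eq) (proj₁ (h j i gt))
    agree : ∀ i j → adj G (f i) (f j) ≡ adj H i j
    agree i j with <-cmp i j
    ... | tri< lt _ _ = proj₂ (h i j lt)
    ... | tri≈ _ refl _ = trans (irrefl G (f i)) (sym (irrefl H i))
    ... | tri> _ _ gt = trans (adj-sym G (f i) (f j)) (trans (proj₂ (h j i gt)) (adj-sym H j i))

  -- Paw-free graphs: the vertices in triangles

  module PawFree (paw-free : Free (complement (P 1 ⊕ P 3)) G) where

    no-paw : ∀ {z p q r} → z ~ p → z ~ q → z ~ r → p ~ q → p ≁ r → q ≁ r → ⊥
    no-paw {z} {p} {q} {r} zp zq zr pq pr qr = paw-free (induced (complement (P 1 ⊕ P 3)) f edges)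
      where
      f : Fin 4 → V
      f 0F = z
      f 1F = p
      -- Complementing P₁ + P₃ makes its isolated vertex adjacent to all and the middle of P₃
      -- pendant.
      f 2F = r
      f 3F = q
      edges : ∀ i j → i <ᶠ j → f i ≢ f j × adj G (f i) (f j) ≡ adj (complement (P 1 ⊕ P 3)) i j
      edges 0F 1F _ = ~⇒≢ zp , zp
      edges 0F 2F _ = ~⇒≢ zr , zr
      edges 0F 3F _ = ~⇒≢ zq , zq
      edges 1F 2F _ = separated (~-sym pq) qr , pr
      edges 1F 3F _ = ~⇒≢ pq , pq
      edges 2F 3F _ = (λ eq → separated pq pr (sym eq)) , ≁-sym qr
      edges 0F 0F ()
      edges 1F 0F ()
      edges 1F 1F (s≤s ())
      edges 2F 0F ()
      edges 2F 1F (s≤s ())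
      edges 2F 2F (s≤s (s≤s ()))
      edges 3F 0F ()
      edges 3F 1F (s≤s ())
      edges 3F 2F (s≤s (s≤s ()))
      edges 3F 3F (s≤s (s≤s (s≤s ())))

    InTriangle : V → Set
    InTriangle v = ∃ λ a → ∃ λ b → v ~ a × v ~ b × a ~ b

    inTriangle? : Decidable InTriangle
    inTriangle? v = any? λ a → any? λ b → (v ~? a) ×-dec (v ~? b) ×-dec (a ~? b)

    -- If `w` missed both `a` and `b`, it would be the pendant vertex of a paw on the triangle `v`,
    -- `a`, `b`.
    edge-in-triangle : ∀ {v w} → InTriangle v → v ~ w → ∃ λ z → v ~ z × w ~ z
    edge-in-triangle {v} {w} (a , b , va , vb , ab) vw with ~-or-≁ w a | ~-or-≁ w b
    ... | inj₁ wa | _ = a , va , wa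
    ... | inj₂ _ | inj₁ wb = b , vb , wb
    ... | inj₂ wa | inj₂ wb = ⊥-elim (no-paw va vb vw ab (≁-sym wa) (≁-sym wb))

    inTriangle-~ : ∀ {v w} → InTriangle v → v ~ w → InTriangle w
    inTriangle-~ t vw with edge-in-triangle t vw
    ... | z , vz , wz = _ , z , ~-sym vw , wz , vz

    -- Twins are non-adjacent, since no vertex is adjacent to itself; among triangle vertices their
    -- classes are the parts of the multipartite components.
    Twins : V → V → Set
    Twins u v = ∀ y → adj G u y ≡ adj G v y

    twins? : ∀ u v → Dec (Twins u v)
    twins? u v = all? λ y → adj G u y ≟ᵇ adj G v y

    private
      -- Otherwise z, w, a, w′ is an induced path; a common neighbour of its middle edge is
      -- adjacent to all of it and yields a paw.
      transfer : ∀ {a w w′ z} → InTriangle a → a ~ w → a ~ w′ → w ≁ w′ → w ~ z → w′ ~ z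
      transfer {a} {w} {w′} {z} ta aw aw′ ww′ wz with ~-or-≁ w′ z
      ... | inj₁ p = p
      ... | inj₂ w′z with ~-or-≁ a z
      ... | inj₁ az = ⊥-elim (no-paw az aw aw′ (~-sym wz) (≁-sym w′z) ww′)
      ... | inj₂ a≁z with edge-in-triangle ta aw
      ... | t , at , wt with ~-or-≁ w′ t | ~-or-≁ z t
      ... | inj₂ w′≁t | _ = ⊥-elim (no-paw aw at aw′ wt ww′ (≁-sym w′≁t))
      ... | inj₁ _ | inj₂ z≁t = ⊥-elim (no-paw (~-sym aw) wt wz at a≁z (≁-sym z≁t))
      ... | inj₁ w′t | inj₁ zt =
        ⊥-elim (no-paw (~-sym zt) (~-sym wt) (~-sym w′t) (~-sym wz) (≁-sym w′z) ww′)

    common-neighbour⇒twins : ∀ {a w w′} → InTriangle a → a ~ w → a ~ w′ → w ≁ w′ → Twins w w′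
    common-neighbour⇒twins {a} {w} {w′} ta aw aw′ ww′ y with ~-or-≁ w y | ~-or-≁ w′ y
    ... | inj₁ p | inj₁ q = trans p (sym q)
    ... | inj₂ p | inj₂ q = trans p (sym q)
    ... | inj₁ p | inj₂ q = ⊥-elim (~-≁-⊥ (transfer ta aw aw′ ww′ p) q)
    ... | inj₂ p | inj₁ q = ⊥-elim (~-≁-⊥ (transfer ta aw′ aw (≁-sym ww′) q) p)

    -- Vertices in no triangle

    Outer : V → Set
    Outer v = ¬ InTriangle v

    outer-~ : ∀ {u v} → Outer u → u ~ v → Outer v
    outer-~ ou uv tv = ou (inTriangle-~ tv (~-sym uv))

    neighbours-independent : ∀ {u v w} → Outer u → u ~ v → u ~ w → v ≁ w
    neighbours-independent {u} {v} {w} ou uv uw with ~-or-≁ v w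
    ... | inj₁ p = ⊥-elim (ou (v , w , uv , uw , p))
    ... | inj₂ p = p

    Independent : ∀ {P} → Three P → Set
    Independent t = x ≁ y × x ≁ z × y ≁ z
      where open Three t

    -- This is R(3,3) = 6. Three neighbours of `p` would be independent; of three non-neighbours,
    -- two would be independent together with `p`, or all three would form a triangle. So the size
    -- is at most 1 + 2 + 2.
    outer-ramsey : ∀ {P} (P? : Decidable P) → (∀ {v} → P v → Outer v) → (∀ (t : Three P) → ¬ Independent t) →
      length (satisfying P?) ≤ 5
    outer-ramsey {P} P? out no-indep = go (satisfying P?) refl
      where
      go : ∀ xs → satisfying P? ≡ xs → length (satisfying P?) ≤ 5
      go [] eq rewrite eq = z≤n
      go (p ∷ xs) eq = ≤-trans (unique-⊆⇒length≤ (satisfying-unique P?) cover)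
          (s≤s (length-++-≤ (satisfying near?) (satisfying far?) (¬three⇒few near? ¬near) (¬three⇒few far? ¬far)))
        where
        pp : P p
        pp = satisfying-∈ P? (subst (p ∈_) (sym eq) (here refl))
        Near Far : V → Set
        Near v = P v × p ~ v
        Far v = P v × p ≢ v × p ≁ v
        near? : Decidable Near
        near? v = P? v ×-dec (p ~? v)
        far? : Decidable Far
        far? v = P? v ×-dec ¬? (p ≟ v) ×-dec (p ≁? v)
        ¬near : ¬ Three Near
        ¬near t@(three _ _ _ (_ , a) (_ , b) (_ , c)) = no-indep (three-map proj₁ t)
          (neighbours-independent (out pp) a b , neighbours-independent (out pp) a c , neighbours-independent (out pp) b c)
        ¬far : ¬ Three Far
        ¬far (three {a} {b} {c} a≢b a≢c b≢c (pa , p≢a , pa≁) (pb , p≢b , pb≁) (pc , p≢c , pc≁))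
          with ~-or-≁ a b | ~-or-≁ a c | ~-or-≁ b c
        ... | inj₂ ab | _ | _ = no-indep (three p≢a p≢b a≢b pp pa pb) (pa≁ , pb≁ , ab)
        ... | inj₁ _ | inj₂ ac | _ = no-indep (three p≢a p≢c a≢c pp pa pc) (pa≁ , pc≁ , ac)
        ... | inj₁ _ | inj₁ _ | inj₂ bc = no-indep (three p≢b p≢c b≢c pp pb pc) (pb≁ , pc≁ , bc)
        ... | inj₁ ab | inj₁ ac | inj₁ bc = out pa (b , c , ab , ac , bc)
        cover : ∀ {v} → v ∈ satisfying P? → v ∈ p ∷ satisfying near? ++ satisfying far?
        cover {v} v∈ with p ≟ v | ~-or-≁ p v
        ... | yes eq′ | _ = here (sym eq′)
        ... | no _ | inj₁ pv = there (∈-++⁺ˡ (∈-satisfying near? (satisfying-∈ P? v∈ , pv)))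
        ... | no p≢v | inj₂ pv = there (∈-++⁺ʳ (satisfying near?) (∈-satisfying far? (satisfying-∈ P? v∈ , p≢v , pv)))

    -- Complements all pairs between the two colour classes of `c`; a constant `c` changes nothing.
    flipped : (V → Bool) → V → V → Bool
    flipped c u v = adj G u v xor (c u xor c v)

    flipped-sym : ∀ c u v → flipped c u v ≡ flipped c v u
    flipped-sym c u v = cong₂ _xor_ (adj-sym G u v) (xor-comm (c u) (c v))

    -- Maximum degree two encodes that, after the deletion and one bipartite complementation, paths
    -- and cycles remain.
    record NearPaths (k : ℕ) : Set where
      field
        exceptional : List V
        few-exceptional : length exceptional ≤ k
        colour : V → Bool
      Rest : V → Set
      Rest v = Outer v × v ∉ exceptional
      field
        degree≤2 : ∀ u → Rest u → ¬ Three (λ v → Rest v × flipped colour u v ≡ true)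

    -- Excluding K₁,₃ + 3P₁

    module Claw+3P₁-Free (claw+3P₁-free : Free (claw ⊕ copies 3 (P 1)) G) where

      -- The leaves of the claw are pairwise non-adjacent because its centre lies in no triangle.
      no-claw+3P₁ : ∀ {u} → Outer u → (b : Three (u ~_)) →
        let module b = Three b in (d : Three (λ w → u ≁ w × b.x ≁ w × b.y ≁ w × b.z ≁ w)) → ¬ Independent d
      no-claw+3P₁ {u} ou (three {b₁} {b₂} {b₃} b₁≢b₂ b₁≢b₃ b₂≢b₃ ub₁ ub₂ ub₃)
        (three {d₁} {d₂} {d₃} d₁≢d₂ d₁≢d₃ d₂≢d₃ (ud₁ , p₁ , q₁ , r₁) (ud₂ , p₂ , q₂ , r₂) (ud₃ , p₃ , q₃ , r₃))
        (d₁₂ , d₁₃ , d₂₃) = claw+3P₁-free (induced (claw ⊕ copies 3 (P 1)) f edges)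
        where
        f : Fin 7 → V
        f 0F = u
        f 1F = b₁
        f 2F = b₂
        f 3F = b₃
        f 4F = d₁
        f 5F = d₂
        f 6F = d₃
        edges : ∀ i j → i <ᶠ j → f i ≢ f j × adj G (f i) (f j) ≡ adj (claw ⊕ copies 3 (P 1)) i j
        edges 0F 1F _ = ~⇒≢ ub₁ , ub₁
        edges 0F 2F _ = ~⇒≢ ub₂ , ub₂
        edges 0F 3F _ = ~⇒≢ ub₃ , ub₃
        edges 0F 4F _ = separated (~-sym ub₁) p₁ , ud₁
        edges 0F 5F _ = separated (~-sym ub₁) p₂ , ud₂
        edges 0F 6F _ = separated (~-sym ub₁) p₃ , ud₃
        edges 1F 2F _ = b₁≢b₂ , neighbours-independent ou ub₁ ub₂
        edges 1F 3F _ = b₁≢b₃ , neighbours-independent ou ub₁ ub₃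
        edges 1F 4F _ = separated ub₁ ud₁ , p₁
        edges 1F 5F _ = separated ub₁ ud₂ , p₂
        edges 1F 6F _ = separated ub₁ ud₃ , p₃
        edges 2F 3F _ = b₂≢b₃ , neighbours-independent ou ub₂ ub₃
        edges 2F 4F _ = separated ub₂ ud₁ , q₁
        edges 2F 5F _ = separated ub₂ ud₂ , q₂
        edges 2F 6F _ = separated ub₂ ud₃ , q₃
        edges 3F 4F _ = separated ub₃ ud₁ , r₁
        edges 3F 5F _ = separated ub₃ ud₂ , r₂
        edges 3F 6F _ = separated ub₃ ud₃ , r₃
        edges 4F 5F _ = d₁≢d₂ , d₁₂
        edges 4F 6F _ = d₁≢d₃ , d₁₃
        edges 5F 6F _ = d₂≢d₃ , d₂₃
        edges (suc _) 0F ()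
        edges 0F 0F ()
        edges (suc i) 1F (s≤s ())
        edges (suc (suc i)) 2F (s≤s (s≤s ()))
        edges (suc (suc (suc i))) 3F (s≤s (s≤s (s≤s ())))
        edges (suc (suc (suc (suc i)))) 4F (s≤s (s≤s (s≤s (s≤s ()))))
        edges (suc (suc (suc (suc (suc i))))) 5F (s≤s (s≤s (s≤s (s≤s (s≤s ())))))
        edges 6F 6F (s≤s (s≤s (s≤s (s≤s (s≤s (s≤s ()))))))

      -- Three neighbours of `u` in `D` are the leaves of a claw centred at `u`, and three
      -- non-neighbours in `D` complete it to K₁,₃ + 3P₁.
      sparse-or-dense : ∀ {D : V → Set} {u} → (∀ {p q} → D p → D q → p ≁ q) → Outer u →
        Three (λ v → D v × u ~ v) → ¬ Three (λ v → D v × u ≁ v)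
      sparse-or-dense {D} {u} indep ou b@(three _ _ _ (D₁ , _) (D₂ , _) (D₃ , _)) d@(three _ _ _ (E₁ , _) (E₂ , _) (E₃ , _)) =
        no-claw+3P₁ ou (three-map proj₂ b) (three-map (λ (Dv , uv) → uv , indep D₁ Dv , indep D₂ Dv , indep D₃ Dv) d)
          (indep E₁ E₂ , indep E₁ E₃ , indep E₂ E₃)

      neighbours : V → List V
      neighbours u = satisfying (u ~?_)

      -- Some vertex of degree at least nine

      module LargeDegree {x : V} (outer-x : Outer x) (large : 9 ≤ length (neighbours x)) where

        outer-nbr : ∀ {b} → x ~ b → Outer b
        outer-nbr = outer-~ outer-x

        nbrs-independent : ∀ {b b′} → x ~ b → x ~ b′ → b ≁ b′
        nbrs-independent = neighbours-independent outer-x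

        Near Missed : V → V → Set
        Near v b = x ~ b × v ~ b
        Missed v b = x ~ b × v ≁ b

        near? : ∀ v → Decidable (Near v)
        near? v b = (x ~? b) ×-dec (v ~? b)
        missed? : ∀ v → Decidable (Missed v)
        missed? v b = (x ~? b) ×-dec (v ≁? b)

        -- Both notions refer to the neighbourhood of `x`; the vertex `x` itself is dense.
        Dense Sparse : V → Set
        Dense v = Outer v × ¬ Three (Missed v)
        Sparse v = Outer v × x ≁ v × Three (Missed v)

        dense? : Decidable Dense
        dense? v = ¬? (inTriangle? v) ×-dec ¬? (three? (missed? v))
        sparse? : Decidable Sparse
        sparse? v = ¬? (inTriangle? v) ×-dec (x ≁? v) ×-dec three? (missed? v)

        trichotomy : ∀ {v} → Outer v → x ~ v ⊎ Dense v ⊎ Sparse v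
        trichotomy {v} ov with ~-or-≁ x v | three? (missed? v)
        ... | inj₁ xv | _ = inj₁ xv
        ... | inj₂ _ | no ¬t = inj₂ (inj₁ (ov , ¬t))
        ... | inj₂ xv | yes t = inj₂ (inj₂ (ov , xv , t))

        missed≤2 : ∀ {v} → Dense v → length (satisfying (missed? v)) ≤ 2
        missed≤2 {v} (_ , ¬t) = ¬three⇒few (missed? v) ¬t

        near≤2 : ∀ {v} → Sparse v → length (satisfying (near? v)) ≤ 2
        near≤2 {v} (ov , _ , t) = ¬three⇒few (near? v) λ t′ → sparse-or-dense nbrs-independent ov t′ t

        common? : ∀ a b c → Decidable (λ v → x ~ v × a ≁ v × b ≁ v × c ≁ v)
        common? a b c v = (x ~? v) ×-dec (a ≁? v) ×-dec (b ≁? v) ×-dec (c ≁? v)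

        -- If three vertices of N(x) are missed by all of three independent sparse vertices, they
        -- form with `x` a claw that the sparse triple completes. Otherwise N(x) has at most 2 + 2 +
        -- 2 + 2 = 8 elements, whence the bound 9.
        sparse≤5 : length (satisfying sparse?) ≤ 5
        sparse≤5 = outer-ramsey sparse? proj₁ no-indep
          where
          no-indep : ∀ (t : Three Sparse) → ¬ Independent t
          no-indep t@(three {a} {b} {c} _ _ _ sa sb sc) indep with three? (common? a b c)
          ... | yes t′@(three _ _ _ (_ , a₁ , b₁ , c₁) (_ , a₂ , b₂ , c₂) (_ , a₃ , b₃ , c₃)) =
            no-claw+3P₁ outer-x (three-map proj₁ t′)
              (three (Three.x≢y t) (Three.x≢z t) (Three.y≢z t)
                (proj₁ (proj₂ sa) , ≁-sym a₁ , ≁-sym a₂ , ≁-sym a₃)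
                (proj₁ (proj₂ sb) , ≁-sym b₁ , ≁-sym b₂ , ≁-sym b₃)
                (proj₁ (proj₂ sc) , ≁-sym c₁ , ≁-sym c₂ , ≁-sym c₃)) indep
          ... | no ¬t = 1+n≰n (≤-trans large (≤-trans (unique-⊆⇒length≤ (satisfying-unique (x ~?_)) cover)
                  (length-++-≤ (satisfying (common? a b c)) _ (¬three⇒few (common? a b c) ¬t)
                    (length-++-≤ (satisfying (near? a)) _ (near≤2 sa)
                      (length-++-≤ (satisfying (near? b)) _ (near≤2 sb) (near≤2 sc))))))
            where
            cover : ∀ {v} → v ∈ neighbours x →
              v ∈ satisfying (common? a b c) ++ satisfying (near? a) ++ satisfying (near? b) ++ satisfying (near? c)
            cover {v} v∈ with ~-or-≁ a v | ~-or-≁ b v | ~-or-≁ c v | satisfying-∈ (x ~?_) v∈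
            ... | inj₁ av | _ | _ | xv = ∈-++⁺ʳ (satisfying (common? a b c)) (∈-++⁺ˡ (∈-satisfying (near? a) (xv , av)))
            ... | inj₂ _ | inj₁ bv | _ | xv = ∈-++⁺ʳ (satisfying (common? a b c))
                    (∈-++⁺ʳ (satisfying (near? a)) (∈-++⁺ˡ (∈-satisfying (near? b) (xv , bv))))
            ... | inj₂ _ | inj₂ _ | inj₁ cv | xv = ∈-++⁺ʳ (satisfying (common? a b c))
                    (∈-++⁺ʳ (satisfying (near? a)) (∈-++⁺ʳ (satisfying (near? b)) (∈-satisfying (near? c) (xv , cv))))
            ... | inj₂ av | inj₂ bv | inj₂ cv | xv = ∈-++⁺ˡ (∈-satisfying (common? a b c) (xv , av , bv , cv))

        -- Adjacent `v` and `w` have no common neighbour, so each of the at least nine neighbours of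
        -- `x` is missed by one of them; but together they miss at most four.
        dense-independent : ∀ {v w} → Dense v → Dense w → v ≁ w
        dense-independent {v} {w} dv dw with ~-or-≁ v w
        ... | inj₂ vw = vw
        ... | inj₁ vw = contradiction (≤-trans large (≤-trans (unique-⊆⇒length≤ (satisfying-unique (x ~?_)) cover)
                (length-++-≤ (satisfying (missed? v)) _ (missed≤2 dv) (missed≤2 dw)))) λ { (s≤s (s≤s (s≤s (s≤s ())))) }
          where
          cover : ∀ {b} → b ∈ neighbours x → b ∈ satisfying (missed? v) ++ satisfying (missed? w)
          cover {b} b∈ with ~-or-≁ v b | ~-or-≁ w b | satisfying-∈ (x ~?_) b∈
          ... | inj₂ vb | _ | xb = ∈-++⁺ˡ (∈-satisfying (missed? v) (xb , vb))
          ... | inj₁ _ | inj₂ wb | xb = ∈-++⁺ʳ (satisfying (missed? v)) (∈-satisfying (missed? w) (xb , wb))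
          ... | inj₁ vb | inj₁ wb | _ = ⊥-elim (proj₁ dv (w , b , vw , vb , wb))

        -- Only neighbours of `x` survive the deletion of the at most 2 + 5 dense and sparse
        -- vertices, and they are independent.
        few-dense : length (satisfying dense?) ≤ 2 → NearPaths 7
        few-dense le = record
          { exceptional = exc
          ; few-exceptional = length-++-≤ (satisfying dense?) _ le sparse≤5
          ; colour = λ _ → false
          ; degree≤2 = λ { u ru (three _ _ _ (rv , uv) _ _) →
              ~-≁-⊥ (trans (sym (xor-identityʳ _)) uv) (nbrs-independent (rest ru) (rest rv)) } }
          where
          exc : List V
          exc = satisfying dense? ++ satisfying sparse?
          rest : ∀ {v} → Outer v × v ∉ exc → x ~ v
          rest (ov , v∉) with trichotomy ov
          ... | inj₁ xv = xv
          ... | inj₂ (inj₁ d) = contradiction (∈-++⁺ˡ (∈-satisfying dense? d)) v∉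
          ... | inj₂ (inj₂ s) = contradiction (∈-++⁺ʳ (satisfying dense?) (∈-satisfying sparse? s)) v∉

        -- Deleting what the three chosen dense vertices miss in N(x) leaves there only vertices
        -- with three dense neighbours, which miss at most two dense vertices by `sparse-or-dense`.
        -- The count is 5 + 2 + 2 + 2.
        many-dense : Three Dense → NearPaths 11
        many-dense (three {y₁} {y₂} {y₃} y₁≢y₂ y₁≢y₃ y₂≢y₃ d₁ d₂ d₃) = record
          { exceptional = exc
          ; few-exceptional = length-++-≤ (satisfying sparse?) _ sparse≤5
              (length-++-≤ (satisfying (missed? y₁)) _ (missed≤2 d₁)
                (length-++-≤ (satisfying (missed? y₂)) _ (missed≤2 d₂) (missed≤2 d₃)))
          -- The flipped edges are then the missing pairs between N(x) and the dense vertices.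
          ; colour = adj G x
          ; degree≤2 = λ u ru t → degree u (rest ru) (three-map (λ (rv , uv) → rest rv , uv) t) }
          where
          exc : List V
          exc = satisfying sparse? ++ satisfying (missed? y₁) ++ satisfying (missed? y₂) ++ satisfying (missed? y₃)
          Kept : V → Set
          Kept v = (x ~ v × y₁ ~ v × y₂ ~ v × y₃ ~ v) ⊎ (x ≁ v × Dense v)
          rest : ∀ {v} → Outer v × v ∉ exc → Kept v
          rest {v} (ov , v∉) with ~-or-≁ x v
          rest {v} (ov , v∉) | inj₂ xv with trichotomy ov
          ... | inj₁ xv′ = ⊥-elim (~-≁-⊥ xv′ xv)
          ... | inj₂ (inj₁ d) = inj₂ (xv , d)
          ... | inj₂ (inj₂ s) = contradiction (∈-++⁺ˡ (∈-satisfying sparse? s)) v∉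
          rest {v} (ov , v∉) | inj₁ xv with ~-or-≁ y₁ v | ~-or-≁ y₂ v | ~-or-≁ y₃ v
          ... | inj₁ p | inj₁ q | inj₁ r = inj₁ (xv , p , q , r)
          ... | inj₂ p | _ | _ = contradiction (∈-++⁺ʳ (satisfying sparse?) (∈-++⁺ˡ (∈-satisfying (missed? y₁) (xv , p)))) v∉
          ... | inj₁ _ | inj₂ q | _ = contradiction (∈-++⁺ʳ (satisfying sparse?) (∈-++⁺ʳ (satisfying (missed? y₁))
                  (∈-++⁺ˡ (∈-satisfying (missed? y₂) (xv , q))))) v∉
          ... | inj₁ _ | inj₁ _ | inj₂ r = contradiction (∈-++⁺ʳ (satisfying sparse?) (∈-++⁺ʳ (satisfying (missed? y₁))
                  (∈-++⁺ʳ (satisfying (missed? y₂)) (∈-satisfying (missed? y₃) (xv , r))))) v∉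
          degree : ∀ u → Kept u → ¬ Three (λ v → Kept v × flipped (adj G x) u v ≡ true)
          degree u (inj₁ (xu , p , q , r)) t = sparse-or-dense dense-independent (outer-nbr xu)
            (three y₁≢y₂ y₁≢y₃ y₂≢y₃ (d₁ , ~-sym p) (d₂ , ~-sym q) (d₃ , ~-sym r)) (three-map missed t)
            where
            missed : ∀ {v} → Kept v × flipped (adj G x) u v ≡ true → Dense v × u ≁ v
            missed {v} (inj₁ (xv , _) , e) rewrite xu | xv | nbrs-independent xu xv = contradiction e λ ()
            missed {v} (inj₂ (xv , d) , e) rewrite xu | xv with adj G u v
            ... | false = d , refl
          degree u (inj₂ (xu , d)) t = proj₂ d (three-map missed t)
            where
            missed : ∀ {v} → Kept v × flipped (adj G x) u v ≡ true → Missed u v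
            missed {v} (inj₂ (xv , d′) , e) rewrite xu | xv | dense-independent d d′ = contradiction e λ ()
            missed {v} (inj₁ (xv , _) , e) rewrite xu | xv with adj G u v
            ... | false = refl , refl

      -- All degrees at most eight

      module SmallDegree (small : ∀ {v} → Outer v → length (neighbours v) ≤ 8) where

        -- The vertices missed by the whole claw contain no independent triple, so they are at most
        -- five. With four neighbourhoods of size at most 8 this makes every outer vertex
        -- exceptional, and the degree condition is vacuous.
        with-claw : ∀ {x} → Outer x → Three (x ~_) → NearPaths 37
        with-claw {x} ox t@(three {a} {b} {c} _ _ _ xa xb xc) = record
          { exceptional = exc
          ; few-exceptional = length-++-≤ (neighbours x) _ (small ox) (length-++-≤ (neighbours a) _ (small (outer-~ ox xa))
              (length-++-≤ (neighbours b) _ (small (outer-~ ox xb)) (length-++-≤ (neighbours c) _ (small (outer-~ ox xc)) far≤5)))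
          ; colour = λ _ → false
          ; degree≤2 = λ { u (ou , u∉) _ → u∉ (everything ou) } }
          where
          Far : V → Set
          Far v = Outer v × x ≁ v × a ≁ v × b ≁ v × c ≁ v
          far? : Decidable Far
          far? v = ¬? (inTriangle? v) ×-dec (x ≁? v) ×-dec (a ≁? v) ×-dec (b ≁? v) ×-dec (c ≁? v)
          far≤5 : length (satisfying far?) ≤ 5
          far≤5 = outer-ramsey far? proj₁ λ t′ → no-claw+3P₁ ox t (three-map proj₂ t′)
          exc : List V
          exc = neighbours x ++ neighbours a ++ neighbours b ++ neighbours c ++ satisfying far?
          everything : ∀ {v} → Outer v → v ∈ exc
          everything {v} ov with ~-or-≁ x v | ~-or-≁ a v | ~-or-≁ b v | ~-or-≁ c v
          ... | inj₁ e | _ | _ | _ = ∈-++⁺ˡ (∈-satisfying (x ~?_) e)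
          ... | inj₂ _ | inj₁ e | _ | _ = ∈-++⁺ʳ (neighbours x) (∈-++⁺ˡ (∈-satisfying (a ~?_) e))
          ... | inj₂ _ | inj₂ _ | inj₁ e | _ = ∈-++⁺ʳ (neighbours x) (∈-++⁺ʳ (neighbours a) (∈-++⁺ˡ (∈-satisfying (b ~?_) e)))
          ... | inj₂ _ | inj₂ _ | inj₂ _ | inj₁ e = ∈-++⁺ʳ (neighbours x) (∈-++⁺ʳ (neighbours a) (∈-++⁺ʳ (neighbours b)
                  (∈-++⁺ˡ (∈-satisfying (c ~?_) e))))
          ... | inj₂ p | inj₂ q | inj₂ r | inj₂ s = ∈-++⁺ʳ (neighbours x) (∈-++⁺ʳ (neighbours a) (∈-++⁺ʳ (neighbours b)
                  (∈-++⁺ʳ (neighbours c) (∈-satisfying far? (ov , p , q , r , s)))))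

        without-claw : (∀ {x} → Outer x → ¬ Three (x ~_)) → NearPaths 0
        without-claw no-claw = record
          { exceptional = [] ; few-exceptional = z≤n ; colour = λ _ → false
          ; degree≤2 = λ { u (ou , _) t → no-claw ou (three-map (λ (_ , e) → trans (sym (xor-identityʳ _)) e) t) } }

      weaken : ∀ {k l} → k ≤ l → NearPaths k → NearPaths l
      weaken le s = record
        { exceptional = exceptional ; few-exceptional = ≤-trans few-exceptional le ; colour = colour ; degree≤2 = degree≤2 }
        where open NearPaths s

      nearPaths : NearPaths 37
      nearPaths with any? (λ x → ¬? (inTriangle? x) ×-dec (9 ≤? length (neighbours x)))
      ... | yes (x , ox , large) = [ weaken (m≤m+n 11 26) ∘ many-dense , weaken (m≤m+n 7 30) ∘ few-dense ]′ (three-or-few dense?)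
        where open LargeDegree ox large
      ... | no none-large = small-case
        where
        open SmallDegree (λ {v} ov → ≮⇒≥ λ lt → none-large (v , ov , lt))
        small-case : NearPaths 37
        small-case with any? (λ x → ¬? (inTriangle? x) ×-dec three? (x ~?_))
        ... | yes (x , ox , t) = with-claw ox t
        ... | no none = weaken z≤n (without-claw λ ox t → none (_ , ox , t))

      -- Layout of a (paw, K₁,₃ + 3P₁)-free graph

      -- The part of the anchor is the one being placed; the vertices of the parts already
      -- completed in its component see all that remains of the component.
      AnchorPattern : V → V → Bool
      AnchorPattern a x = adj G a x ∨ ⌊ twins? a x ⌋

      -- The three shapes stand for finished components, the part being placed, and the completed
      -- parts of the same component.
      record PartsInv (L : List V) : Set where
        field
          inside : ∀ {u} → u ∈ L → InTriangle u
          anchor : V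
          shape : ∀ u → u ∈ L →
            Covers L (λ _ → false) u ⊎ Covers L (adj G anchor) u ⊎ Covers L (AnchorPattern anchor) u

      covers-∷ : ∀ {L r u} w → Covers L r u → Covers (w ∷ L) r u
      covers-∷ w c x x∉ = c x (x∉ ∘ there)

      parts-few : ∀ {L k} → PartsInv L → FewPatterns (3 + k) L
      parts-few {L} {k} i = fewPatterns ((λ _ → false) ∷ adj G anchor ∷ AnchorPattern anchor ∷ []) (m≤m+n 3 k) cover
        where
        open PartsInv i
        cover : ∀ u → u ∈ L → ∃ λ r → r ∈ _ × Covers L r u
        cover u u∈ with shape u u∈
        ... | inj₁ c = _ , here refl , c
        ... | inj₂ (inj₁ c) = _ , there (here refl) , c
        ... | inj₂ (inj₂ c) = _ , there (there (here refl)) , c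

      -- Twins complete the part of the anchor, then a neighbour of the anchor opens the next part;
      -- when neither is left the component is finished and `v` starts another.
      parts-step : ∀ {L} → PartsInv L → ∀ v → v ∉ L → InTriangle v → ∃ λ w → w ∉ L × PartsInv (w ∷ L)
      parts-step {L} i v v∉ tv = step
        where
        open PartsInv i
        inside-∷ : ∀ {w} → InTriangle w → ∀ {u} → u ∈ w ∷ L → InTriangle u
        inside-∷ tw (here refl) = tw
        inside-∷ tw (there u∈) = inside u∈

        Candidate : (V → Set) → V → Set
        Candidate Q w = w ∉ L × InTriangle w × Q w
        candidate? : ∀ {Q} → Decidable Q → Dec (∃ (Candidate Q))
        candidate? Q? = any? λ w → ¬? (w ∈? L) ×-dec inTriangle? w ×-dec Q? w

        add-twin : ∀ {w} → Candidate (Twins anchor) w → PartsInv (w ∷ L)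
        add-twin {w} (_ , tw , tws) = record { inside = inside-∷ tw ; anchor = anchor ; shape = shape′ }
          where
          shape′ : ∀ u → u ∈ w ∷ L → _
          shape′ u (here refl) = inj₂ (inj₁ λ x _ → sym (tws x))
          shape′ u (there u∈) with shape u u∈
          ... | inj₁ c = inj₁ (covers-∷ w c)
          ... | inj₂ (inj₁ c) = inj₂ (inj₁ (covers-∷ w c))
          ... | inj₂ (inj₂ c) = inj₂ (inj₂ (covers-∷ w c))

        module NoTwins (no-twin : ¬ ∃ (Candidate (Twins anchor))) where

          add-neighbour : ∀ {w} → Candidate (anchor ~_) w → PartsInv (w ∷ L)
          add-neighbour {w} (_ , tw , aw) = record { inside = inside-∷ tw ; anchor = w ; shape = shape′ }
            where
            ta : InTriangle anchor
            ta = inTriangle-~ tw (~-sym aw)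
            not-twins : ∀ {x} → x ∉ L → ¬ Twins anchor x
            not-twins {x} x∉ tws = no-twin (x , x∉ , inTriangle-~ tw (~-sym (trans (sym (tws w)) aw)) , tws)
            -- A neighbour of `anchor` that misses `w` is a twin of `w`. An unplaced neighbour of
            -- `w` sees `anchor`, since otherwise it would be an unplaced twin of it.
            new-pattern : ∀ {x} → x ∉ L → adj G anchor x ≡ AnchorPattern w x
            new-pattern {x} x∉ with ~-or-≁ anchor x | ~-or-≁ w x
            ... | inj₁ ax | inj₁ wx rewrite ax | wx = refl
            ... | inj₁ ax | inj₂ wx rewrite ax | wx = sym (⌊⌋-yes (twins? w x) (common-neighbour⇒twins ta aw ax wx))
            ... | inj₂ ax | inj₁ wx = contradiction (common-neighbour⇒twins tw (~-sym aw) wx ax) (not-twins x∉)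
            ... | inj₂ ax | inj₂ wx rewrite ax | wx =
              sym (⌊⌋-no (twins? w x) λ tws → ~-≁-⊥ (~-sym aw) (trans (tws anchor) (≁-sym ax)))
            shape′ : ∀ u → u ∈ w ∷ L → _
            shape′ u (here refl) = inj₂ (inj₁ λ x _ → refl)
            shape′ u (there u∈) with shape u u∈
            ... | inj₁ c = inj₁ (covers-∷ w c)
            ... | inj₂ (inj₁ c) = inj₂ (inj₂ λ x x∉ → trans (c x (x∉ ∘ there)) (new-pattern (x∉ ∘ there)))
            -- Without unplaced twins of the old anchor, its pattern reduces to adjacency to it.
            ... | inj₂ (inj₂ c) = inj₂ (inj₂ λ x x∉ → trans (c x (x∉ ∘ there)) (trans (trans
                    (cong (adj G anchor x ∨_) (⌊⌋-no (twins? anchor x) (not-twins (x∉ ∘ there)))) (∨-identityʳ _))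
                    (new-pattern (x∉ ∘ there))))

          start-afresh : ¬ ∃ (Candidate (anchor ~_)) → PartsInv (v ∷ L)
          start-afresh no-nbr = record { inside = inside-∷ tv ; anchor = v ; shape = shape′ }
            where
            -- An unplaced neighbour would lie in a triangle too and would be a neighbour or a twin
            -- of `anchor`, and both are exhausted.
            finished : ∀ u → u ∈ L → Covers L (λ _ → false) u
            finished u u∈ x x∉ with ~-or-≁ u x
            ... | inj₂ ux = ux
            ... | inj₁ ux with inTriangle-~ (inside u∈) ux | shape u u∈
            ... | tx | inj₁ c = c x x∉
            ... | tx | inj₂ (inj₁ c) = contradiction (x , x∉ , tx , trans (sym (c x x∉)) ux) no-nbr
            ... | tx | inj₂ (inj₂ c) with ~-or-≁ anchor x | twins? anchor x | trans (sym (c x x∉)) ux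
            ... | inj₁ ax | _ | _ = contradiction (x , x∉ , tx , ax) no-nbr
            ... | inj₂ _ | yes tws | _ = contradiction (x , x∉ , tx , tws) no-twin
            ... | inj₂ ax | no _ | e rewrite ax = contradiction e λ ()
            shape′ : ∀ u → u ∈ v ∷ L → _
            shape′ u (here refl) = inj₂ (inj₁ λ x _ → refl)
            shape′ u (there u∈) = inj₁ (covers-∷ v (finished u u∈))

        step : ∃ λ w → w ∉ L × PartsInv (w ∷ L)
        step with candidate? (twins? anchor)
        ... | yes (w , cand) = w , proj₁ cand , add-twin cand
        ... | no no-twin with candidate? (anchor ~?_)
        ... | yes (w , cand) = w , proj₁ cand , NoTwins.add-neighbour no-twin cand
        ... | no no-nbr = v , v∉ , NoTwins.start-afresh no-twin no-nbr

      inTriangle-≁ : ∀ {u x} → InTriangle u → Outer x → u ≁ x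
      inTriangle-≁ {u} {x} tu ox with ~-or-≁ u x
      ... | inj₁ ux = contradiction (inTriangle-~ tu ux) ox
      ... | inj₂ ux = ux

      -- The three phases: triangles, exceptional vertices, paths and cycles

      module Phases {k : ℕ} (s : NearPaths k) where
        open NearPaths s

        record ExceptionalInv (L : List V) : Set where
          field
            triangles : ∀ {v} → InTriangle v → v ∈ L
            kinds : ∀ {v} → v ∈ L → InTriangle v ⊎ v ∈ exceptional

        exceptional-few : ∀ {L} → ExceptionalInv L → FewPatterns (5 + k) L
        exceptional-few {L} i = fewPatterns ((λ _ → false) ∷ map (adj G) exceptional)
            (s≤s (≤-trans (≤-reflexive (length-map (adj G) exceptional)) (≤-trans few-exceptional (m≤n+m k 4)))) cover
          where
          open ExceptionalInv i
          cover : ∀ u → u ∈ L → ∃ λ r → r ∈ _ × Covers L r u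
          cover u u∈ with kinds u∈
          ... | inj₁ tu = _ , here refl , λ x x∉ → inTriangle-≁ tu (x∉ ∘ triangles)
          ... | inj₂ eu = _ , there (∈-map⁺ (adj G) eu) , λ _ _ → refl

        exceptional-step : ∀ {L} → ExceptionalInv L → ∀ v → v ∉ L → v ∈ exceptional → ∃ λ w → w ∉ L × ExceptionalInv (w ∷ L)
        exceptional-step i v v∉ ev = v , v∉ , record
          { triangles = there ∘ triangles
          ; kinds = λ { (here refl) → inj₂ ev ; (there u∈) → kinds u∈ } }
          where open ExceptionalInv i

        infix 4 _≈>_
        _≈>_ : V → V → Set
        u ≈> v = flipped colour u v ≡ true

        AtMostOne : List V → V → Set
        AtMostOne L a = ∀ {x y} → x ∉ L → y ∉ L → a ≈> x → a ≈> y → x ≡ y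

        -- At most two edges of the flipped graph leave L: they leave a single vertex
        -- (of degree at most two), or at most one leaves each of two vertices.
        record PathsInv (L : List V) : Set where
          field
            rest : ∀ {v} → v ∉ L → Rest v
            a b : V
            active : ∀ {u x} → u ∈ L → Rest u → x ∉ L → u ≈> x → u ≡ a ⊎ u ≡ b
            ends : a ≡ b ⊎ (AtMostOne L a × AtMostOne L b)

        -- The neighbourhood of a vertex of colour `c` with no flipped edge leaving the segment:
        -- exactly the other colour.
        colour-pattern : Bool → V → Bool
        colour-pattern c x = c xor colour x

        -- One pattern serves the triangle vertices, two the inactive vertices by colour, two the
        -- ends, and one each exceptional vertex.
        paths-few : ∀ {L} → PathsInv L → FewPatterns (5 + k) L
        paths-few {L} i = fewPatterns R
            (s≤s (s≤s (s≤s (s≤s (s≤s (≤-trans (≤-reflexive (length-map (adj G) exceptional)) few-exceptional)))))) cover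
          where
          open PathsInv i
          R : List (V → Bool)
          R = (λ _ → false) ∷ colour-pattern true ∷ colour-pattern false ∷ adj G a ∷ adj G b ∷ map (adj G) exceptional
          cover : ∀ u → u ∈ L → ∃ λ r → r ∈ R × Covers L r u
          cover u u∈ with inTriangle? u | u ∈? exceptional | u ≟ a | u ≟ b
          ... | yes tu | _ | _ | _ = _ , here refl , λ x x∉ → inTriangle-≁ tu (proj₁ (rest x∉))
          ... | no _ | yes eu | _ | _ = _ , there (there (there (there (there (∈-map⁺ (adj G) eu))))) , λ _ _ → refl
          ... | no _ | no _ | yes refl | _ = _ , there (there (there (here refl))) , λ _ _ → refl
          ... | no _ | no _ | no _ | yes refl = _ , there (there (there (there (here refl)))) , λ _ _ → refl
          ... | no ou | no u∉ | no u≢a | no u≢b = colour-pattern (colour u) , listed (colour u) , inactive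
            where
            listed : ∀ c → colour-pattern c ∈ R
            listed true = there (here refl)
            listed false = there (there (here refl))
            inactive : Covers L (colour-pattern (colour u)) u
            inactive x x∉ with adj G u x | colour u xor colour x | active u∈ (ou , u∉) x∉
            ... | true | true | _ = refl
            ... | false | false | _ = refl
            ... | true | false | h = contradiction (h refl) [ u≢a , u≢b ]′
            ... | false | true | h = contradiction (h refl) [ u≢a , u≢b ]′

        -- A flipped edge leaving `L` is followed; if there is none, the current path or cycle is
        -- complete and a new one starts at `v`.
        paths-step : ∀ {L} → PathsInv L → ∀ v → v ∉ L → ∃ λ w → w ∉ L × PathsInv (w ∷ L)
        paths-step {L} i v v∉ with any? (λ u → any? (λ w →
            (u ∈? L) ×-dec (¬? (inTriangle? u) ×-dec ¬? (u ∈? exceptional)) ×-dec ¬? (w ∈? L) ×-dec (flipped colour u w ≟ᵇ true)))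
        ... | no none = v , v∉ , record
          { rest = λ x∉ → rest (x∉ ∘ there)
          ; a = v ; b = v
          ; active = λ { (here refl) _ _ _ → inj₁ refl
                       ; (there u∈) ru x∉ ux → contradiction (_ , _ , u∈ , ru , x∉ ∘ there , ux) none }
          ; ends = inj₁ refl }
          where open PathsInv i
        ... | yes (u , w , u∈ , ru , w∉ , uw) = w , w∉ , next
          where
          open PathsInv i
          drop : ∀ {c} → AtMostOne L c → AtMostOne (w ∷ L) c
          drop h x∉ y∉ = h (x∉ ∘ there) (y∉ ∘ there)
          rest-∷ : ∀ {x} → x ∉ w ∷ L → Rest x
          rest-∷ x∉ = rest (x∉ ∘ there)
          end-w : AtMostOne (w ∷ L) w
          end-w {x} {y} x∉ y∉ wx wy with x ≟ y
          ... | yes eq = eq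
          ... | no x≢y = contradiction
            (three x≢y (λ { refl → x∉ (there u∈) }) (λ { refl → y∉ (there u∈) })
              (rest-∷ x∉ , wx) (rest-∷ y∉ , wy) (ru , trans (flipped-sym colour w u) uw))
            (degree≤2 w (rest w∉))
          end-u : AtMostOne (w ∷ L) u
          end-u {x} {y} x∉ y∉ ux uy with x ≟ y
          ... | yes eq = eq
          ... | no x≢y = contradiction
            (three x≢y (x∉ ∘ here) (y∉ ∘ here) (rest-∷ x∉ , ux) (rest-∷ y∉ , uy) (rest w∉ , uw))
            (degree≤2 u ru)
          -- The only edge that left `u` led to `w`, so `w` takes over as the end in place of `u`.
          replace : ∀ {c} → (∀ {u′ x} → u′ ∈ L → Rest u′ → x ∉ L → u′ ≈> x → u′ ≡ u ⊎ u′ ≡ c) →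
            AtMostOne L u → AtMostOne L c → PathsInv (w ∷ L)
          replace {c} act one-u one-c = record
            { rest = rest-∷ ; a = w ; b = c
            ; active = λ { (here refl) _ _ _ → inj₁ refl ; (there u′∈) ru′ x∉ ux → still u′∈ ru′ x∉ ux }
            ; ends = inj₂ (end-w , drop one-c) }
            where
            still : ∀ {u′ x} → u′ ∈ L → Rest u′ → x ∉ w ∷ L → u′ ≈> x → u′ ≡ w ⊎ u′ ≡ c
            still u′∈ ru′ x∉ ux with act u′∈ ru′ (x∉ ∘ there) ux
            ... | inj₂ eq = inj₂ eq
            ... | inj₁ refl = contradiction (here (one-u (x∉ ∘ there) w∉ ux uw)) x∉
          next : PathsInv (w ∷ L)
          next with active u∈ ru w∉ uw | ends
          ... | inj₁ refl | inj₂ (one-a , one-b) = replace active one-a one-b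
          ... | inj₂ refl | inj₂ (one-a , one-b) = replace (λ p q r t → swap (active p q r t)) one-b one-a
          -- Here `u` is the start of the path and remains an end, as a second edge may still leave
          -- it.
          ... | e | inj₁ refl with [ id , id ]′ e
          ... | refl = record
            { rest = rest-∷ ; a = w ; b = u
            ; active = λ { (here refl) _ _ _ → inj₁ refl
                         ; (there u′∈) ru′ x∉ ux → inj₂ ([ id , id ]′ (active u′∈ ru′ (x∉ ∘ there) ux)) }
            ; ends = inj₂ (end-w , end-u) }

        module Triangles = Greedy {5 + k} PartsInv InTriangle inTriangle? parts-few parts-step
        module Exceptional = Greedy {5 + k} ExceptionalInv (_∈ exceptional) (_∈? exceptional) exceptional-few exceptional-step
        module Paths = Greedy {5 + k} PathsInv (λ _ → ⊤) (λ _ → yes tt) paths-few (λ i v v∉ _ → paths-step i v v∉)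

        -- The vertex `v₀` fills the anchor and the ends of the invariants at the start of a phase.
        spanning-layout : V → ∃ λ L → Layout (5 + k) L × (∀ v → v ∈ L)
        spanning-layout v₀ with Triangles.extend [] (record { inside = λ () ; anchor = v₀ ; shape = λ _ () })
        ... | _ , l₁ , i₁ , all₁ with Exceptional.extend l₁ (record
                { triangles = all₁ _ ; kinds = inj₁ ∘ PartsInv.inside i₁ })
        ... | _ , l₂ , i₂ , all₂ with Paths.extend l₂ (record
                { rest = λ v∉ → v∉ ∘ ExceptionalInv.triangles i₂ , v∉ ∘ all₂ _
                ; a = v₀ ; b = v₀
                ; active = λ u∈ ru _ _ → [ (λ t → contradiction t (proj₁ ru)) , (λ e → contradiction e (proj₂ ru)) ]′
                             (ExceptionalInv.kinds i₂ u∈)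
                ; ends = inj₁ refl })
        ... | L , l₃ , _ , all₃ = L , l₃ , λ v → all₃ v tt

theorem2 : BoundedCliqueWidth (λ G → Free (complement (P 1 ⊕ P 3)) G × Free (claw ⊕ copies 3 (P 1)) G)
-- At most 37 exceptional vertices give 5 + 37 = 42 patterns and 2 * (42 + 1) = 86 labels.
theorem2 = 86 , bound
  where
  bound : ∀ {n} (G : Graph n) → Free (complement (P 1 ⊕ P 3)) G × Free (claw ⊕ copies 3 (P 1)) G → CwAtMost 86 G
  bound {zero} G _ = inj₁ refl
  bound {suc n} G (paw-free , claw+3P₁-free) = Layouts.spanning-layout⇒cw G (proj₁ (proj₂ layout)) (proj₂ (proj₂ layout))
    where
    open Forbidden.PawFree G paw-free
    open Claw+3P₁-Free claw+3P₁-free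
    layout : ∃ λ L → Layouts.Layout G 42 L × (∀ v → v ∈ L)
    layout = Phases.spanning-layout nearPaths zero
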